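{- For every constant $\epsilon>0$, no deterministic online algorithm is $\left(\frac{1}{2}+\epsilon\right)$-competitive for the maximum-weight online bipartite left-perfect matching problem under vertex arrivals with hard budget $k=4$ on the number of reassignments, even when all edge weights are in $\{0,1\}$.
   Context: Problem. Let $G=(L\cup R,E)$ be a complete bipartite graph with $|L|\le|R|$ and nonnegative edge weights $w:E\to\mathbb{Q}_{\ge 0}$. The algorithm initially knows $R$ and $k=4$. Over $|L|$ timesteps the vertices of $L$ arrive one at a time, each revealed together with the weights of all its incident edges. At the end of each timestep the algorithm must output a left-perfect matching of the current graph (a matching covering every arrived vertex of $L$), obtained from its previous matching (initially $\emptyset$) by at most $k$ (re)assignments, where the number of (re)assignments needed to go from matching $M_1$ to matching $M_2$ is the number of vertices incident to at least one edge of $M_1\triangle M_2$. Once a vertex is matched it must remain matched. An algorithm is $\rho$-competitive if there is a constant $c\ge0$ such that on every instance the final matching has weight at least $\rho\cdot\mathsf{OPT}-c$, where $\mathsf{OPT}$ is the maximum weight of a left-perfect matching in $G$. -}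

module Defs where

open import Data.Nat using (ℕ; zero; suc; _⊔_) renaming (_≤_ to _≤ℕ_)
open import Data.Fin using (Fin; zero; suc)
open import Data.Fin.Properties using (_≟_)
open import Data.Bool using (Bool; true; false; _xor_; not)
open import Data.Maybe using (Maybe; just; nothing)
open import Data.List using (List; []; _∷_; length; filter; upTo; allFin; foldr; zipWith; _++_; [_])
open import Data.Bool.ListAction using (any)
open import Data.List.Relation.Unary.All using (All)
open import Data.List.Relation.Unary.Unique.Propositional using (Unique)
open import Data.Rational using (ℚ; 0ℚ; 1ℚ; ½; _+_; _-_; _*_; _≤_; _<_)
open import Data.Product using (Σ; _×_; ∃; ∃-syntax)
open import Data.Sum using (_⊎_)
open import Relation.Binary.PropositionalEquality using (_≡_)
open import Relation.Nullary.Decidable using (⌊_⌋; does)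

-- Right side R = Fin r.  Left vertices are 0,1,2,... in order of arrival.
-- An arriving left vertex is given by its weight vector  Fin r → ℚ  (weights
-- of its edges to all of R; the graph is complete bipartite).
Arrival : ℕ → Set
Arrival r = Fin r → ℚ

-- A (left-perfect) assignment for the first t left vertices is a list of
-- length t whose i-th entry is the right vertex matched to left vertex i.
Assignment : ℕ → Set
Assignment r = List (Fin r)

at : ∀ {A : Set} → List A → ℕ → Maybe A
at []       _       = nothing
at (x ∷ xs) zero    = just x
at (x ∷ xs) (suc i) = at xs i

inM : ∀ {r} → Assignment r → ℕ → Fin r → Bool
inM M i j with at M i
... | nothing = false
... | just j′ = does (j′ ≟ j)

inDiff : ∀ {r} → Assignment r → Assignment r → ℕ → Fin r → Bool
inDiff M₁ M₂ i j = inM M₁ i j xor inM M₂ i j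

reassignments : ∀ {r} → Assignment r → Assignment r → ℕ
reassignments {r} M₁ M₂ =
  length (filter (λ i → any (λ j → inDiff M₁ M₂ i j) (allFin r) ≟B) (upTo N))
  Data.Nat.+ length (filter (λ j → any (λ i → inDiff M₁ M₂ i j) (upTo N) ≟B) (allFin r))
  where
  N = length M₁ ⊔ length M₂
  open import Relation.Nullary using (Dec)
  open import Data.Bool.Properties using () renaming (_≟_ to _≟b_)
  _≟B : (b : Bool) → Dec (b ≡ true)
  b ≟B = b ≟b true

IsLeftPerfect : ∀ {r} → ℕ → Assignment r → Set
IsLeftPerfect t M = (length M ≡ t) × Unique M

sumℚ : List ℚ → ℚ
sumℚ = foldr _+_ 0ℚ

weight : ∀ {r} → List (Arrival r) → Assignment r → ℚ
weight ws M = sumℚ (zipWith (λ w j → w j) ws M)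

IsOPT : ∀ {r} → List (Arrival r) → ℚ → Set
IsOPT {r} ws v =
  (∃[ M ] (IsLeftPerfect (length ws) M × weight ws M ≡ v)) ×
  (∀ (M : Assignment r) → IsLeftPerfect (length ws) M → weight ws M ≤ v)

NonNeg : ∀ {r} → Arrival r → Set
NonNeg w = ∀ j → 0ℚ ≤ w j

ZeroOne : ∀ {r} → Arrival r → Set
ZeroOne w = ∀ j → (w j ≡ 0ℚ) ⊎ (w j ≡ 1ℚ)

-- A deterministic online algorithm knowing R (via r); its matching after
-- timestep t is a function of the vertices arrived so far (in arrival order).
Algorithm : Set
Algorithm = (r : ℕ) → List (Arrival r) → Assignment r

Feasible : ℕ → Algorithm → Set
Feasible k A =
  ∀ (r : ℕ) (ws : List (Arrival r)) → All NonNeg ws → length ws ≤ℕ r →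
    IsLeftPerfect (length ws) (A r ws) ×
    (∀ (w : Arrival r) → NonNeg w → suc (length ws) ≤ℕ r →
       reassignments (A r ws) (A r (ws ++ [ w ])) ≤ℕ k)

CompetitiveOn : (∀ {r} → Arrival r → Set) → ℚ → Algorithm → Set
CompetitiveOn P ρ A =
  ∃[ c ] (0ℚ ≤ c ×
    (∀ (r : ℕ) (ws : List (Arrival r)) → All P ws → length ws ≤ℕ r →
       ∀ (opt : ℚ) → IsOPT ws opt → (ρ * opt) - c ≤ weight ws (A r ws)))

{-# OPTIONS --safe #-}
-- With four reassignments a step can displace at most one old vertex, and this
-- vertex then moves to a previously unused right vertex: right vertices stay
-- occupied.  Let |R| = 4n.  First 2n vertices of weight 0 arrive, occupying X.
-- Then n vertices with weight 1 exactly on X arrive; let P be the set of their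
-- partners.  Finally n vertices with weight 1 exactly on P arrive.  Since X is
-- occupied all along, a vertex of the second group never regains a place in X
-- outside P once it has left its own, so all weight 1 is earned on P and the
-- algorithm gets at most n.  The optimum is 2n: third group on P, second group on X ∖ P.
module Submission where

open import Defs
open import Data.Rational using (ℚ; 0ℚ; ½; _+_; _<_)
open import Relation.Nullary using (¬_)

open import Data.Bool using (Bool; true; false; if_then_else_; _∨_)
open import Data.Bool.ListAction using (any)
open import Data.Bool.Properties using (∨-zeroʳ)
open import Data.Empty using (⊥-elim)
open import Data.Fin using (Fin)
import Data.Fin.Properties as Fin
import Data.Integer as ℤ
import Data.Integer.Properties as ℤ
open import Data.List using (List; []; _∷_; [_]; _++_; length; filter; upTo; allFin; replicate; drop)
open import Data.List.Properties
  using (length-++; length-++-sucʳ; length-replicate; length-drop; length-tabulate; ++-assoc; ++-identityʳ)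
open import Data.List.Membership.Propositional using (_∈_; _∉_; find)
open import Data.List.Membership.Propositional.Properties
  using (∈-++⁺ˡ; ∈-++⁺ʳ; ∈-++⁻; ∈-∃++; ∈-filter⁺; ∈-filter⁻; ∈-upTo⁺; ∈-allFin)
import Data.List.Membership.DecPropositional as DecMembership
open import Data.List.Relation.Binary.Disjoint.Propositional using (Disjoint)
open import Data.List.Relation.Binary.Subset.Propositional using (_⊆_)
open import Data.List.Relation.Unary.All as All using (All; []; _∷_)
import Data.List.Relation.Unary.All.Properties as All
import Data.List.Relation.Unary.Any as Any
open import Data.List.Relation.Unary.Any using (here; there)
open import Data.List.Relation.Unary.AllPairs using ([]; _∷_)
open import Data.List.Relation.Unary.Unique.Propositional using (Unique)
import Data.List.Relation.Unary.Unique.Propositional.Properties as Unique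
open import Data.Maybe using (just; nothing)
open import Data.Maybe.Properties using (just-injective)
open import Data.Nat as ℕ using (ℕ; zero; suc; z≤n; s≤s; _⊔_)
import Data.Nat.Coprimality as Coprimality
import Data.Nat.Properties as ℕ
open import Data.Product using (_×_; _,_; proj₁; proj₂; ∃-syntax)
open import Data.Rational using (1ℚ; _*_; _-_; _≤_; mkℚ; *<*; 1/_; positive)
import Data.Rational.Properties as ℚ
open import Data.Rational.Solver using (module +-*-Solver)
open import Data.Rational.Unnormalised using (*≡*)
import Data.Rational.Unnormalised.Properties as ℚᵘ
open import Algebra.Properties.Monoid.Mult ℚ.+-0-monoid using () renaming (_×_ to _·_; ×-homo-+ to ·-homo-+)
open import Data.Sum using (_⊎_; inj₁; inj₂)
open import Level using (0ℓ)
open import Function using (_∘_)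
open import Relation.Binary.PropositionalEquality
  using (_≡_; _≢_; refl; sym; trans; cong; cong₂; subst; subst₂; module ≡-Reasoning)
open import Relation.Nullary using (yes; no; does; contradiction)
open import Relation.Nullary.Decidable using (¬?; dec-true; decidable-stable)
open import Relation.Unary using (Pred; Decidable)

private
  variable
    S : Set
    r : ℕ

module _ {r : ℕ} where
  open DecMembership (Fin._≟_ {r}) public using (_∈?_)

-- Lists without repetition

-- Pigeonhole by induction on `xs`: cut one occurrence of the head out of `ys`. Since the head does
-- not recur in the tail, the tail still lies in what is left.
unique⊆⇒length≤ : {xs ys : List S} → Unique xs → xs ⊆ ys → length xs ℕ.≤ length ys
unique⊆⇒length≤ {xs = []} _ _ = z≤n
unique⊆⇒length≤ {xs = x ∷ xs} (x∉ ∷ u) sub with ∈-∃++ (sub (here refl))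
... | as , bs , refl = subst (suc (length xs) ℕ.≤_) (sym (length-++-sucʳ as x bs)) (s≤s (unique⊆⇒length≤ u rest))
  where
  rest : xs ⊆ as ++ bs
  rest z∈xs with ∈-++⁻ as (sub (there z∈xs))
  ... | inj₁ z∈as = ∈-++⁺ˡ z∈as
  ... | inj₂ (here z≡x) = ⊥-elim (All.lookup x∉ z∈xs (sym z≡x))
  ... | inj₂ (there z∈bs) = ∈-++⁺ʳ as z∈bs

fresh : (xs : List (Fin r)) {ys : List (Fin r)} → Unique ys → length xs ℕ.< length ys →
  ∃[ y ] (y ∈ ys × y ∉ xs)
fresh xs {ys} u lt with Any.any? (λ y → ¬? (y ∈? xs)) ys
... | yes p = find p
... | no ¬p = contradiction (unique⊆⇒length≤ u covered) (ℕ.<⇒≱ lt)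
  where
  covered : ys ⊆ xs
  covered {y} y∈ys = decidable-stable (y ∈? xs) λ y∉xs → ¬p (Any.map (λ { refl → y∉xs }) y∈ys)

-- Greedy choice: each chosen element joins the list to be avoided, so `k` drops by one while that
-- list grows by one and the counting bound persists.
choose-avoiding : ∀ k (xs : List (Fin r)) {ys : List (Fin r)} → Unique ys → k ℕ.+ length xs ℕ.≤ length ys →
  ∃[ zs ] (length zs ≡ k × Unique zs × zs ⊆ ys × Disjoint zs xs)
choose-avoiding zero xs u le = [] , refl , [] , (λ ()) , λ { (() , _) }
choose-avoiding (suc k) xs {ys} u le
  with y , y∈ys , y∉xs ← fresh xs u (ℕ.≤-trans (s≤s (ℕ.m≤n+m _ k)) le)
  with zs , len , uzs , sub , disj ← choose-avoiding k (y ∷ xs) u (subst (ℕ._≤ length ys) (sym (ℕ.+-suc k (length xs))) le)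
  = y ∷ zs , cong suc len
  , All.tabulate (λ { z∈zs refl → disj (z∈zs , here refl) }) ∷ uzs
  , (λ { (here refl) → y∈ys ; (there z∈zs) → sub z∈zs })
  , λ { (here refl , z∈xs) → y∉xs z∈xs ; (there z∈zs , z∈xs) → disj (z∈zs , there z∈xs) }

-- Positions in lists.

at⇒∈ : ∀ (xs : List S) i {x} → at xs i ≡ just x → x ∈ xs
at⇒∈ (x ∷ xs) zero refl = here refl
at⇒∈ (x ∷ xs) (suc i) eq = there (at⇒∈ xs i eq)

∈⇒at : ∀ {xs : List S} {x} → x ∈ xs → ∃[ i ] at xs i ≡ just x
∈⇒at (here refl) = zero , refl
∈⇒at (there x∈xs) with i , eq ← ∈⇒at x∈xs = suc i , eq

at⇒< : ∀ (xs : List S) i {x} → at xs i ≡ just x → i ℕ.< length xs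
at⇒< (x ∷ xs) zero eq = s≤s z≤n
at⇒< (x ∷ xs) (suc i) eq = s≤s (at⇒< xs i eq)

<⇒at : ∀ (xs : List S) {i} → i ℕ.< length xs → ∃[ x ] at xs i ≡ just x
<⇒at (x ∷ xs) {zero} _ = x , refl
<⇒at (x ∷ xs) {suc i} (s≤s lt) = <⇒at xs lt

at-length : ∀ (xs : List S) → at xs (length xs) ≡ nothing
at-length [] = refl
at-length (x ∷ xs) = at-length xs

at-injective : ∀ {xs : List S} → Unique xs → ∀ i k {x} → at xs i ≡ just x → at xs k ≡ just x → i ≡ k
at-injective (_ ∷ _) zero zero _ _ = refl
at-injective {xs = _ ∷ xs} (x∉ ∷ _) zero (suc k) refl eq = ⊥-elim (All.lookup x∉ (at⇒∈ xs k eq) refl)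
at-injective {xs = _ ∷ xs} (x∉ ∷ _) (suc i) zero eq refl = ⊥-elim (All.lookup x∉ (at⇒∈ xs i eq) refl)
at-injective (_ ∷ u) (suc i) (suc k) eq eq′ = cong suc (at-injective u i k eq eq′)

-- In the second case the bound on `i` lets a partner be located in `drop (n + n) M₂`. Membership in
-- `ys` identifies the weight vector, as each block of arrivals is constant.
at-++⁻ : ∀ (xs : List S) {ys} i {x} → at (xs ++ ys) i ≡ just x →
  at xs i ≡ just x ⊎ (length xs ℕ.≤ i × x ∈ ys)
at-++⁻ [] {ys} i eq = inj₂ (z≤n , at⇒∈ ys i eq)
at-++⁻ (x ∷ xs) zero eq = inj₁ eq
at-++⁻ (x ∷ xs) (suc i) eq with at-++⁻ xs i eq
... | inj₁ eq′ = inj₁ eq′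
... | inj₂ (le , x∈ys) = inj₂ (s≤s le , x∈ys)

at⇒∈-drop : ∀ m (xs : List S) {i x} → m ℕ.≤ i → at xs i ≡ just x → x ∈ drop m xs
at⇒∈-drop zero xs {i} _ eq = at⇒∈ xs i eq
at⇒∈-drop (suc m) (x ∷ xs) {suc i} (s≤s le) eq = at⇒∈-drop m xs le eq

∈-replicate⁻ : ∀ n {x y : S} → y ∈ replicate n x → y ≡ x
∈-replicate⁻ n = All.lookup (All.replicate⁺ {P = _≡ _} n refl)

-- A single step with four reassignments

any-true : (f : S → Bool) {xs : List S} {x : S} → x ∈ xs → f x ≡ true → any f xs ≡ true
any-true f (here refl) eq rewrite eq = refl
any-true f {y ∷ _} (there x∈xs) eq = trans (cong (f y ∨_) (any-true f x∈xs eq)) (∨-zeroʳ (f y))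

-- Distinct witnesses form a list without repetition inside the filtered list, so pigeonhole bounds
-- its length from below.
length-filter≥2 : {P : Pred S 0ℓ} (P? : Decidable P) {xs : List S} {a b : S} → a ∈ xs → b ∈ xs → P a → P b → a ≢ b →
  2 ℕ.≤ length (filter P? xs)
length-filter≥2 P? a∈ b∈ pa pb a≢b =
  unique⊆⇒length≤ {xs = _ ∷ _ ∷ []} ((a≢b ∷ []) ∷ [] ∷ [])
    λ { (here refl) → ∈-filter⁺ P? a∈ pa ; (there (here refl)) → ∈-filter⁺ P? b∈ pb }

length-filter≥3 : {P : Pred S 0ℓ} (P? : Decidable P) {xs : List S} {a b c : S} → a ∈ xs → b ∈ xs → c ∈ xs →
  P a → P b → P c → a ≢ b → a ≢ c → b ≢ c → 3 ℕ.≤ length (filter P? xs)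
length-filter≥3 P? a∈ b∈ c∈ pa pb pc a≢b a≢c b≢c =
  unique⊆⇒length≤ {xs = _ ∷ _ ∷ _ ∷ []} ((a≢b ∷ a≢c ∷ []) ∷ (b≢c ∷ []) ∷ [] ∷ [])
    λ { (here refl) → ∈-filter⁺ P? a∈ pa ; (there (here refl)) → ∈-filter⁺ P? b∈ pb
      ; (there (there (here refl))) → ∈-filter⁺ P? c∈ pc }

inM-true : ∀ (M : Assignment r) i {j} → at M i ≡ just j → inM M i j ≡ true
inM-true M i {j} eq with at M i | eq
... | just _ | refl = dec-true (j Fin.≟ j) refl

inM-false : ∀ (M : Assignment r) i {j} → at M i ≢ just j → inM M i j ≡ false
inM-false M i {j} neq with at M i
... | nothing = refl
... | just j′ with j′ Fin.≟ j
...   | yes refl = ⊥-elim (neq refl)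
...   | no _ = refl

inDiff-old : ∀ (M M′ : Assignment r) i {j} → at M i ≡ just j → at M′ i ≢ just j → inDiff M M′ i j ≡ true
inDiff-old M M′ i eq neq rewrite inM-true M i eq | inM-false M′ i neq = refl

inDiff-new : ∀ (M M′ : Assignment r) i {j} → at M i ≢ just j → at M′ i ≡ just j → inDiff M M′ i j ≡ true
inDiff-new M M′ i neq eq rewrite inM-false M i neq | inM-true M′ i eq = refl

module _ {r : ℕ} (M M′ : Assignment r) (unique′ : Unique M′)
         (length′ : length M′ ≡ suc (length M)) (budget : reassignments M M′ ℕ.≤ 4) where

  -- Otherwise the step touches the two left vertices i and length M and the
  -- three right vertices j, j′ and j″.
  displaced-by-arrival : ∀ {i j j′ j″} → at M i ≡ just j → at M′ i ≡ just j′ →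
    at M′ (length M) ≡ just j″ → j ≢ j′ → j ≡ j″
  displaced-by-arrival {i} {j} {j′} {j″} eq eq′ eq″ j≢j′ with j Fin.≟ j″
  ... | yes j≡j″ = j≡j″
  ... | no j≢j″ = contradiction budget (ℕ.<⇒≱ (ℕ.+-mono-≤
      (length-filter≥2 _ (left i<) (left new<)
        (any-true (λ j → inDiff M M′ i j) (∈-allFin j) d₁)
        (any-true (λ j → inDiff M M′ (length M) j) (∈-allFin j″) d₃) i≢new)
      (length-filter≥3 _ (∈-allFin j) (∈-allFin j′) (∈-allFin j″)
        (any-true (λ i → inDiff M M′ i j) (left i<) d₁)
        (any-true (λ i → inDiff M M′ i j′) (left i<) d₂)
        (any-true (λ i → inDiff M M′ i j″) (left new<) d₃)
        j≢j′ j≢j″ j′≢j″)))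
    where
    i<M : i ℕ.< length M
    i<M = at⇒< M i eq
    i< : i ℕ.< length M′
    i< = at⇒< M′ i eq′
    new< : length M ℕ.< length M′
    new< = at⇒< M′ (length M) eq″
    left : ∀ {k} → k ℕ.< length M′ → k ∈ upTo (length M ⊔ length M′)
    left k< = ∈-upTo⁺ (ℕ.≤-trans k< (ℕ.m≤n⊔m (length M) (length M′)))
    i≢new : i ≢ length M
    i≢new = ℕ.<⇒≢ i<M
    j′≢j″ : j′ ≢ j″
    j′≢j″ refl = i≢new (at-injective unique′ i (length M) eq′ eq″)
    d₁ : inDiff M M′ i j ≡ true
    d₁ = inDiff-old M M′ i eq λ e → j≢j′ (just-injective (trans (sym e) eq′))
    d₂ : inDiff M M′ i j′ ≡ true
    d₂ = inDiff-new M M′ i (λ e → j≢j′ (just-injective (trans (sym eq) e))) eq′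
    d₃ : inDiff M M′ (length M) j″ ≡ true
    d₃ = inDiff-new M M′ (length M) (λ e → contradiction (trans (sym e) (at-length M)) λ ()) eq″

-- Stability of the matching along a run.

-- The second component says that an old left vertex never moves onto a right vertex occupied in
-- `M`. Its bound on `i` exempts later arrivals, which may take the place of a displaced vertex.
-- Unlike "at most one vertex is displaced", this relation survives composition.
Stable : Assignment r → Assignment r → Set
Stable M M′ = M ⊆ M′ × (∀ i {j} → i ℕ.< length M → at M′ i ≡ just j → j ∈ M → at M i ≡ just j)

-- Both halves rest on `displaced-by-arrival`. If the holder of `j` moves, the arrival takes over
-- `j`, which therefore stays occupied and is closed to every other old vertex.
stable-step : ∀ (M M′ : Assignment r) → Unique M → Unique M′ → length M′ ≡ suc (length M) →
  reassignments M M′ ℕ.≤ 4 → Stable M M′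
stable-step M M′ uM uM′ len budget = occupied , settled
  where
  t = length M
  new : ∃[ j ] at M′ t ≡ just j
  new = <⇒at M′ (ℕ.≤-reflexive (sym len))
  old : ∀ {i} → i ℕ.< t → ∃[ j ] at M′ i ≡ just j
  old i<t = <⇒at M′ (ℕ.≤-trans i<t (ℕ.≤-trans (ℕ.n≤1+n t) (ℕ.≤-reflexive (sym len))))

  occupied : M ⊆ M′
  occupied {j} j∈M
    with i , eq ← ∈⇒at j∈M
    with j′ , eq′ ← old (at⇒< M i eq)
    with j Fin.≟ j′
  ... | yes refl = at⇒∈ M′ i eq′
  ... | no j≢j′ = at⇒∈ M′ t
    (trans (proj₂ new) (cong just (sym (displaced-by-arrival M M′ uM′ len budget eq eq′ (proj₂ new) j≢j′))))

  settled : ∀ i {j} → i ℕ.< t → at M′ i ≡ just j → j ∈ M → at M i ≡ just j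
  settled i {j′} i<t eq′ j′∈M
    with j , eq ← <⇒at M i<t
    with k , eqk ← ∈⇒at j′∈M
    with l , eql ← old (at⇒< M k eqk)
    with j Fin.≟ j′
  ... | yes refl = eq
  ... | no j≢j′ with j′ Fin.≟ l
  -- Here `k`, the holder of `j′` in `M`, has not moved, so it is `i` itself and `j` equals `j′`.
  ...   | yes refl = ⊥-elim (j≢j′ (just-injective (trans (sym eq) (subst (λ k → at M k ≡ _) (at-injective uM′ k i eql eq′) eqk))))
  -- Here `k` was displaced from `j′`, so the arrival holds `j′` in `M′`; but `i` holds it too.
  ...   | no j′≢l = ⊥-elim (ℕ.<⇒≢ i<t (at-injective uM′ i t eq′
          (trans (proj₂ new) (cong just (sym (displaced-by-arrival M M′ uM′ len budget eqk eql (proj₂ new) j′≢l))))))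

stable-refl : (M : Assignment r) → Stable M M
stable-refl M = (λ x → x) , λ _ _ eq _ → eq

-- The second components compose only through the first: a vertex occupied in `M` is occupied in
-- `M′` as well, so the later stability applies to it.
stable-trans : ∀ {M M′ M″ : Assignment r} → length M ℕ.≤ length M′ → Stable M M′ → Stable M′ M″ → Stable M M″
stable-trans le (⊆₁ , s₁) (⊆₂ , s₂) =
  ⊆₂ ∘ ⊆₁ , λ i i< eq j∈M → s₁ i i< (s₂ i (ℕ.<-≤-trans i< le) eq (⊆₁ j∈M)) j∈M

-- Induction on the later arrivals, moving the head to the end of the prefix. Every intermediate
-- matching is then an output of `A`, and consecutive outputs satisfy `stable-step`.
stable-run : ∀ {A : Algorithm} → Feasible 4 A → ∀ r (ws ws′ : List (Arrival r)) → All NonNeg (ws ++ ws′) →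
  length (ws ++ ws′) ℕ.≤ r → Stable (A r ws) (A r (ws ++ ws′))
stable-run {A} F r ws [] nn le = subst (λ v → Stable (A r ws) (A r v)) (sym (++-identityʳ ws)) (stable-refl _)
stable-run {A} F r ws (w ∷ ws′) nn le =
  subst (λ v → Stable (A r ws) (A r v)) assoc
    (stable-trans (subst₂ ℕ._≤_ (sym (proj₁ lp)) (sym (trans (proj₁ lp′) len)) (ℕ.n≤1+n _))
      (stable-step _ _ (proj₂ lp) (proj₂ lp′) (trans (proj₁ lp′) (trans len (cong suc (sym (proj₁ lp)))))
        (proj₂ (F r ws nnws le₀) w nnw le₁))
      (stable-run F r (ws ++ [ w ]) ws′ nn′ le′))
  where
  assoc : (ws ++ [ w ]) ++ ws′ ≡ ws ++ w ∷ ws′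
  assoc = ++-assoc ws [ w ] ws′
  nn′ : All NonNeg ((ws ++ [ w ]) ++ ws′)
  nn′ = subst (All NonNeg) (sym assoc) nn
  le′ : length ((ws ++ [ w ]) ++ ws′) ℕ.≤ r
  le′ = subst (λ v → length v ℕ.≤ r) (sym assoc) le
  len : length (ws ++ [ w ]) ≡ suc (length ws)
  len = trans (length-++ ws) (ℕ.+-comm _ 1)
  le₂ : length (ws ++ [ w ]) ℕ.≤ r
  le₂ = ℕ.≤-trans (ℕ.≤-trans (ℕ.m≤m+n _ _) (ℕ.≤-reflexive (sym (length-++ (ws ++ [ w ]))))) le′
  le₁ : suc (length ws) ℕ.≤ r
  le₁ = subst (ℕ._≤ r) len le₂
  le₀ : length ws ℕ.≤ r
  le₀ = ℕ.≤-trans (ℕ.n≤1+n _) le₁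
  nnws : All NonNeg ws
  nnws = All.++⁻ˡ ws nn
  nnw : NonNeg w
  nnw = All.head (All.++⁻ʳ ws nn)
  lp : IsLeftPerfect (length ws) (A r ws)
  lp = proj₁ (F r ws nnws le₀)
  lp′ : IsLeftPerfect (length (ws ++ [ w ])) (A r (ws ++ [ w ]))
  lp′ = proj₁ (F r (ws ++ [ w ]) (All.++⁻ˡ (ws ++ [ w ]) nn′) le₂)

-- Weights

0≤1 : 0ℚ ≤ 1ℚ
0≤1 = ℚ.nonNegative⁻¹ 1ℚ

-- Counts enter the rationals as monoid multiples of `1ℚ`, so that estimates follow the recursion on
-- `n`; explicit fractions appear only for the Archimedean property.
0≤n·1 : ∀ n → 0ℚ ≤ n · 1ℚ
0≤n·1 zero = ℚ.≤-refl
0≤n·1 (suc n) = ℚ.+-mono-≤ 0≤1 (0≤n·1 n)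

·1-mono : ∀ {m n} → m ℕ.≤ n → m · 1ℚ ≤ n · 1ℚ
·1-mono {n = n} z≤n = 0≤n·1 n
·1-mono (s≤s le) = ℚ.+-monoʳ-≤ 1ℚ (·1-mono le)

zeroOne⇒nonNeg : {w : Arrival r} → ZeroOne w → NonNeg w
zeroOne⇒nonNeg z j with z j
... | inj₁ eq = ℚ.≤-reflexive (sym eq)
... | inj₂ eq = ℚ.≤-trans 0≤1 (ℚ.≤-reflexive (sym eq))

indicator : List (Fin r) → Arrival r
indicator X j = if does (j ∈? X) then 1ℚ else 0ℚ

indicator-∈ : ∀ (X : List (Fin r)) {j} → j ∈ X → indicator X j ≡ 1ℚ
indicator-∈ X {j} j∈X rewrite dec-true (j ∈? X) j∈X = refl

indicator-cases : ∀ (X : List (Fin r)) j → indicator X j ≡ 0ℚ ⊎ (indicator X j ≡ 1ℚ × j ∈ X)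
indicator-cases X j with j ∈? X
... | yes j∈X = inj₂ (refl , j∈X)
... | no _ = inj₁ refl

indicator-zeroOne : ∀ (X : List (Fin r)) → ZeroOne (indicator X)
indicator-zeroOne X j with indicator-cases X j
... | inj₁ eq = inj₁ eq
... | inj₂ (eq , _) = inj₂ eq

weight-++ : ∀ (ws ws′ : List (Arrival r)) (M M′ : Assignment r) → length ws ≡ length M →
  weight (ws ++ ws′) (M ++ M′) ≡ weight ws M + weight ws′ M′
weight-++ [] ws′ [] M′ _ = sym (ℚ.+-identityˡ _)
weight-++ (w ∷ ws) ws′ (j ∷ M) M′ len =
  trans (cong (w j +_) (weight-++ ws ws′ M M′ (ℕ.suc-injective len))) (sym (ℚ.+-assoc (w j) _ _))

weight-replicate : ∀ n {w : Arrival r} {c} (M : Assignment r) → length M ≡ n → (∀ {j} → j ∈ M → w j ≡ c) →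
  weight (replicate n w) M ≡ n · c
weight-replicate zero _ _ _ = refl
weight-replicate (suc n) (j ∷ M) len eq =
  cong₂ _+_ (eq (here refl)) (weight-replicate n M (ℕ.suc-injective len) (eq ∘ there))

weight≤length : ∀ {ws : List (Arrival r)} → All ZeroOne ws → ∀ M → weight ws M ≤ length ws · 1ℚ
weight≤length [] M = ℚ.≤-refl
-- `zipWith` stops at the shorter list, so an exhausted matching has weight `0ℚ`.
weight≤length {ws = w ∷ ws} (z ∷ zs) [] = 0≤n·1 (suc (length ws))
weight≤length (z ∷ zs) (j ∷ M) with z j
... | inj₁ eq rewrite eq = ℚ.+-mono-≤ 0≤1 (weight≤length zs M)
... | inj₂ eq rewrite eq = ℚ.+-monoʳ-≤ 1ℚ (weight≤length zs M)

weight-zeros++≤ : ∀ m {ws : List (Arrival r)} → All ZeroOne ws → ∀ M →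
  weight (replicate m (λ _ → 0ℚ) ++ ws) M ≤ length ws · 1ℚ
weight-zeros++≤ zero zs M = weight≤length zs M
weight-zeros++≤ (suc m) {ws} zs [] = 0≤n·1 (length ws)
weight-zeros++≤ (suc m) zs (j ∷ M) = ℚ.≤-trans (ℚ.≤-reflexive (ℚ.+-identityˡ _)) (weight-zeros++≤ m zs M)

-- A charging argument: each unit of weight is charged to the right vertex it is earned on, an entry
-- of `M` satisfying `P`. The hypothesis goes by position because the weight earned on `j` depends
-- on which left vertex holds `j`.
weight≤filter : ∀ {P : Pred (Fin r) 0ℓ} (P? : Decidable P) (ws : List (Arrival r)) M →
  (∀ i {w j} → at ws i ≡ just w → at M i ≡ just j → w j ≡ 0ℚ ⊎ (w j ≡ 1ℚ × P j)) →
  weight ws M ≤ length (filter P? M) · 1ℚ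
weight≤filter P? [] M h = 0≤n·1 (length (filter P? M))
weight≤filter P? (w ∷ ws) [] h = ℚ.≤-refl
weight≤filter P? (w ∷ ws) (j ∷ M) h with h zero refl refl | P? j | weight≤filter P? ws M (λ i → h (suc i))
... | inj₁ eq | yes _ | ih rewrite eq = ℚ.+-mono-≤ 0≤1 ih
... | inj₁ eq | no _ | ih rewrite eq = ℚ.≤-trans (ℚ.≤-reflexive (ℚ.+-identityˡ _)) ih
... | inj₂ (eq , _) | yes _ | ih rewrite eq = ℚ.+-monoʳ-≤ 1ℚ ih
... | inj₂ (_ , Pj) | no ¬Pj | _ = contradiction Pj ¬Pj

-- The adversary

module Adversary (A : Algorithm) (F : Feasible 4 A) (n : ℕ) where
  R : ℕ
  -- As many right vertices as there will be arrivals, `2n + n + n`.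
  R = n ℕ.+ n ℕ.+ n ℕ.+ n

  zeros : List (Arrival R)
  zeros = replicate (n ℕ.+ n) (λ _ → 0ℚ)

  X : Assignment R
  X = A R zeros

  ws₂ : List (Arrival R)
  ws₂ = zeros ++ replicate n (indicator X)

  -- Entries follow the order of arrival, so dropping the first `2n` leaves the partners of the
  -- second group.
  M₂ P : Assignment R
  M₂ = A R ws₂
  P = drop (n ℕ.+ n) M₂

  ws₃ : List (Arrival R)
  ws₃ = ws₂ ++ replicate n (indicator P)

  M₃ : Assignment R
  M₃ = A R ws₃

  length-zeros : length zeros ≡ n ℕ.+ n
  length-zeros = length-replicate (n ℕ.+ n)

  length-ws₂ : length ws₂ ≡ n ℕ.+ n ℕ.+ n
  length-ws₂ = trans (length-++ zeros) (cong₂ ℕ._+_ length-zeros (length-replicate n))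

  length-ws₃ : length ws₃ ≡ R
  length-ws₃ = trans (length-++ ws₂) (cong₂ ℕ._+_ length-ws₂ (length-replicate n))

  length-ws₃≤R : length ws₃ ℕ.≤ R
  length-ws₃≤R = ℕ.≤-reflexive length-ws₃

  length-ws₂≤R : length ws₂ ℕ.≤ R
  length-ws₂≤R = ℕ.≤-trans (ℕ.≤-reflexive length-ws₂) (ℕ.m≤m+n _ n)

  length-zeros≤R : length zeros ℕ.≤ R
  length-zeros≤R = ℕ.≤-trans (ℕ.≤-reflexive length-zeros) (ℕ.≤-trans (ℕ.m≤m+n _ n) (ℕ.m≤m+n _ n))

  zeroOne-zeros : All ZeroOne zeros
  zeroOne-zeros = All.replicate⁺ (n ℕ.+ n) (λ _ → inj₁ refl)

  zeroOne-ws₂ : All ZeroOne ws₂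
  zeroOne-ws₂ = All.++⁺ zeroOne-zeros (All.replicate⁺ n (indicator-zeroOne X))

  zeroOne-ws₃ : All ZeroOne ws₃
  zeroOne-ws₃ = All.++⁺ zeroOne-ws₂ (All.replicate⁺ n (indicator-zeroOne P))

  nonNeg : ∀ {ws : List (Arrival R)} → All ZeroOne ws → All NonNeg ws
  nonNeg = All.map zeroOne⇒nonNeg

  perfect : ∀ {ws} → All ZeroOne ws → length ws ℕ.≤ R → IsLeftPerfect (length ws) (A R ws)
  perfect {ws} z le = proj₁ (F R ws (nonNeg z) le)

  length-X : length X ≡ n ℕ.+ n
  length-X = trans (proj₁ (perfect zeroOne-zeros length-zeros≤R)) length-zeros

  unique-X : Unique X
  unique-X = proj₂ (perfect zeroOne-zeros length-zeros≤R)

  length-M₂ : length M₂ ≡ n ℕ.+ n ℕ.+ n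
  length-M₂ = trans (proj₁ (perfect zeroOne-ws₂ length-ws₂≤R)) length-ws₂

  length-P : length P ≡ n
  length-P = trans (length-drop (n ℕ.+ n) M₂)
    (trans (cong (ℕ._∸ (n ℕ.+ n)) length-M₂) (ℕ.m+n∸m≡n (n ℕ.+ n) n))

  unique-P : Unique P
  unique-P = Unique.drop⁺ (n ℕ.+ n) (proj₂ (perfect zeroOne-ws₂ length-ws₂≤R))

  -- This turns `j ∈ X` into `j ∈ M₂`, the premise under which `M₂-M₃-stable` determines the earlier
  -- holder of `j`.
  X⊆M₂ : X ⊆ M₂
  X⊆M₂ = proj₁ (stable-run F R zeros (replicate n (indicator X)) (nonNeg zeroOne-ws₂) length-ws₂≤R)

  M₂-M₃-stable : Stable M₂ M₃
  M₂-M₃-stable = stable-run F R ws₂ (replicate n (indicator P)) (nonNeg zeroOne-ws₃) length-ws₃≤R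

  -- By groups: the first earns nothing, and the third has weight only on `P`. If a vertex of the
  -- second group ends on `j` in `X`, stability shows that it already held `j` in `M₂`, which puts
  -- `j` in `P`.
  earned-on-P : ∀ i {w j} → at ws₃ i ≡ just w → at M₃ i ≡ just j → w j ≡ 0ℚ ⊎ (w j ≡ 1ℚ × j ∈ P)
  earned-on-P i {w} {j} eqw eqj with at-++⁻ ws₂ i eqw
  ... | inj₂ (_ , w∈) rewrite ∈-replicate⁻ n w∈ = indicator-cases P j
  ... | inj₁ eqw₂ with at-++⁻ zeros i eqw₂
  ...   | inj₁ eqw₁ rewrite ∈-replicate⁻ (n ℕ.+ n) (at⇒∈ zeros i eqw₁) = inj₁ refl
  ...   | inj₂ (le , w∈) rewrite ∈-replicate⁻ n w∈ with indicator-cases X j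
  ...     | inj₁ eq = inj₁ eq
  ...     | inj₂ (eq , j∈X) = inj₂ (eq , at⇒∈-drop (n ℕ.+ n) M₂ (subst (ℕ._≤ i) length-zeros le)
            (proj₂ M₂-M₃-stable i i<M₂ eqj (X⊆M₂ j∈X)))
    where
    i<M₂ : i ℕ.< length M₂
    i<M₂ = subst (i ℕ.<_) (trans length-ws₂ (sym length-M₂)) (at⇒< ws₂ i eqw₂)

  -- `M₃` has no repetition, so at most `length P` of its entries lie in `P`.
  weight-M₃≤n : weight ws₃ M₃ ≤ n · 1ℚ
  weight-M₃≤n = ℚ.≤-trans (weight≤filter (_∈? P) ws₃ M₃ earned-on-P) (·1-mono
    (subst (length (filter (_∈? P) M₃) ℕ.≤_) length-P
      (unique⊆⇒length≤ (Unique.filter⁺ (_∈? P) (proj₂ (perfect zeroOne-ws₃ length-ws₃≤R)))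
        (λ {j} → proj₂ ∘ ∈-filter⁻ (_∈? P) {v = j} {xs = M₃}))))

  -- As `X` has `2n` elements and `P` only `n`, some `n` elements `Q` of `X` avoid `P`, wherever `P`
  -- lies. The second group goes to `Q`, the third to `P` and the weightless first group to the
  -- remaining `Z`.
  optimal-matching : ∃[ M ] (IsLeftPerfect (length ws₃) M × weight ws₃ M ≡ (n ℕ.+ n) · 1ℚ)
  optimal-matching
    with Q , length-Q , unique-Q , Q⊆X , Q∩P ←
           choose-avoiding n P unique-X (ℕ.≤-reflexive (trans (cong (n ℕ.+_) length-P) (sym length-X)))
    with length-Q++P ← trans (length-++ Q) (cong₂ ℕ._+_ length-Q length-P)
    -- An exact fit: `2n` vertices to choose, `2n` to avoid and `4n` in all.
    with Z , length-Z , unique-Z , _ , Z∩QP ←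
           choose-avoiding (n ℕ.+ n) (Q ++ P) (Unique.allFin⁺ R)
             (ℕ.≤-reflexive (trans (cong (n ℕ.+ n ℕ.+_) length-Q++P)
               (trans (sym (ℕ.+-assoc (n ℕ.+ n) n n)) (sym (length-tabulate {n = R} (λ i → i))))))
    with length-Z++Q ← trans (length-++ Z {Q}) (cong₂ ℕ._+_ length-Z length-Q)
    = (Z ++ Q) ++ P
    , ( trans (length-++ (Z ++ Q)) (trans (cong₂ ℕ._+_ length-Z++Q length-P) (sym length-ws₃))
      , subst Unique (sym (++-assoc Z Q P)) (Unique.++⁺ unique-Z (Unique.++⁺ unique-Q unique-P Q∩P) Z∩QP))
    , (begin
        weight ws₃ ((Z ++ Q) ++ P)
          ≡⟨ weight-++ ws₂ _ (Z ++ Q) P (trans length-ws₂ (sym length-Z++Q)) ⟩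
        weight ws₂ (Z ++ Q) + weight (replicate n (indicator P)) P
          ≡⟨ cong₂ _+_ (weight-++ zeros _ Z Q (trans length-zeros (sym length-Z)))
               (weight-replicate n P length-P (indicator-∈ P)) ⟩
        weight zeros Z + weight (replicate n (indicator X)) Q + n · 1ℚ
          ≡⟨ cong (_+ n · 1ℚ) (cong₂ _+_ (weight-replicate (n ℕ.+ n) Z length-Z (λ _ → refl))
               (weight-replicate n Q length-Q (indicator-∈ X ∘ Q⊆X))) ⟩
        (n ℕ.+ n) · 0ℚ + n · 1ℚ + n · 1ℚ
          ≡⟨ cong (λ z → z + n · 1ℚ + n · 1ℚ) (·-zeroʳ (n ℕ.+ n)) ⟩
        0ℚ + n · 1ℚ + n · 1ℚ
          ≡⟨ cong (_+ n · 1ℚ) (ℚ.+-identityˡ (n · 1ℚ)) ⟩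
        n · 1ℚ + n · 1ℚ
          ≡⟨ ·-homo-+ 1ℚ n n ⟨
        (n ℕ.+ n) · 1ℚ ∎)
    where
    open ≡-Reasoning
    ·-zeroʳ : ∀ m → m · 0ℚ ≡ 0ℚ
    ·-zeroʳ zero = refl
    ·-zeroʳ (suc m) = trans (ℚ.+-identityˡ _) (·-zeroʳ m)

  -- For the upper bound the arrivals are regrouped as `2n` zero vectors followed by `2n` vectors
  -- that contribute at most `1ℚ` each.
  isOPT : IsOPT ws₃ ((n ℕ.+ n) · 1ℚ)
  isOPT = optimal-matching , λ M _ → subst₂ (λ v m → weight v M ≤ m · 1ℚ) (sym (++-assoc zeros _ _))
    (trans (length-++ (replicate n (indicator X))) (cong₂ ℕ._+_ (length-replicate n) (length-replicate n)))
    (weight-zeros++≤ (n ℕ.+ n)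
      (All.++⁺ (All.replicate⁺ n (indicator-zeroOne X)) (All.replicate⁺ n (indicator-zeroOne P))) M)

-- The Archimedean property and the final estimate.

-- Passing to unnormalised rationals reduces the equality to cross-multiplication and keeps
-- coprimality proofs out of it.
n·1≡n/1 : ∀ n → n · 1ℚ ≡ mkℚ (ℤ.+ n) 0 (Coprimality.sym (Coprimality.1-coprimeTo n))
n·1≡n/1 zero = ℚ.toℚᵘ-injective (*≡* refl)
n·1≡n/1 (suc n) rewrite n·1≡n/1 n = ℚ.toℚᵘ-injective (ℚᵘ.≃-trans
  (ℚ.toℚᵘ-homo-+ 1ℚ (mkℚ (ℤ.+ n) 0 (Coprimality.sym (Coprimality.1-coprimeTo n))))
  (*≡* (cong (λ m → (ℤ.1ℤ ℤ.+ m) ℤ.* ℤ.1ℤ) (ℤ.*-identityʳ (ℤ.+ n)))))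

archimedean : ∀ q → ∃[ n ] q < n · 1ℚ
-- The denominator of `q` is `suc d`, so with the witness `∣p∣ + 1` the claim reads
-- `p < (∣p∣ + 1)(d + 1)`.
archimedean q@(mkℚ p d _) = suc ℤ.∣ p ∣ , subst (q <_) (sym (n·1≡n/1 (suc ℤ.∣ p ∣))) (*<* (begin-strict
  p ℤ.* ℤ.1ℤ               ≡⟨ ℤ.*-identityʳ p ⟩
  p                        ≤⟨ i≤∣i∣ p ⟩
  ℤ.+ ℤ.∣ p ∣                <⟨ ℤ.+<+ (ℕ.n<1+n _) ⟩
  ℤ.+ suc ℤ.∣ p ∣            ≤⟨ ℤ.+≤+ (ℕ.m≤m*n (suc ℤ.∣ p ∣) (suc d)) ⟩
  ℤ.+ suc ℤ.∣ p ∣ ℤ.* ℤ.+ suc d ∎))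
  where
  open ℤ.≤-Reasoning
  i≤∣i∣ : ∀ i → i ℤ.≤ ℤ.+ ℤ.∣ i ∣
  i≤∣i∣ (ℤ.+ _) = ℤ.≤-refl
  i≤∣i∣ ℤ.-[1+ _ ] = ℤ.-≤+

exceeds-multiple : ∀ c {ε} → 0ℚ < ε → ∃[ n ] c < n · 1ℚ * ε
exceeds-multiple c {ε} 0<ε = n , subst (_< n · 1ℚ * ε) c/ε*ε≡c (ℚ.*-monoˡ-<-pos ε c/ε<n)
  where
  instance
    pos = positive 0<ε
    nz = ℚ.pos⇒nonZero ε
  n = proj₁ (archimedean (c * 1/ ε))
  c/ε<n = proj₂ (archimedean (c * 1/ ε))
  c/ε*ε≡c : c * 1/ ε * ε ≡ c
  c/ε*ε≡c = trans (ℚ.*-assoc c (1/ ε) ε) (trans (cong (c *_) (ℚ.*-inverseˡ ε)) (ℚ.*-identityʳ c))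

theorem4 : ∀ (ε : ℚ) → 0ℚ < ε → ∀ (A : Algorithm) → Feasible 4 A →
    ¬ CompetitiveOn ZeroOne (½ + ε) A
theorem4 ε 0<ε A F (c , _ , competitive) =
  ℚ.<-irrefl refl (ℚ.<-≤-trans excess (ℚ.≤-trans (competitive R ws₃ zeroOne-ws₃ length-ws₃≤R _ isOPT) weight-M₃≤n))
  where
  -- The demanded share of the optimum `2n` is `n + 2nε`. Taking `c < 2nε` makes it exceed `n` even
  -- after `c` is subtracted.
  n,c<2nε = exceeds-multiple c (ℚ.+-mono-< 0<ε 0<ε)
  n = proj₁ n,c<2nε
  N = n · 1ℚ
  open Adversary A F n
  -- The variable `h` stands for `½`, so the solver handles a pure ring identity; `½ + ½` evaluates
  -- to `1ℚ` in `excess`.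
  split : ∀ h e N c → (h + e) * (N + N) - c ≡ ((h + h) * N - c) + N * (e + e)
  split = solve 4 (λ h e N c → (h :+ e) :* (N :+ N) :- c := ((h :+ h) :* N :- c) :+ N :* (e :+ e)) refl
    where open +-*-Solver
  cancel : ∀ N c → N - c + c ≡ N
  cancel = solve 2 (λ N c → N :- c :+ c := N) refl
    where open +-*-Solver
  open ℚ.≤-Reasoning
  excess : N < (½ + ε) * ((n ℕ.+ n) · 1ℚ) - c
  excess = begin-strict
    N                                      ≡⟨ cancel N c ⟨
    N - c + c                              <⟨ ℚ.+-monoʳ-< (N - c) (proj₂ n,c<2nε) ⟩
    N - c + N * (ε + ε)                    ≡⟨ cong (λ m → m - c + N * (ε + ε)) (ℚ.*-identityˡ N) ⟨
    (½ + ½) * N - c + N * (ε + ε)          ≡⟨ split ½ ε N c ⟨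
    (½ + ε) * (N + N) - c                  ≡⟨ cong (λ m → (½ + ε) * m - c) (·-homo-+ 1ℚ n n) ⟨
    (½ + ε) * ((n ℕ.+ n) · 1ℚ) - c         ∎
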